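{- Let $p,q\ge 1$ be coprime integers, $n=p+q$, and let $\mathsf{T}_c$ be the lower Christoffel word of length $n$ determined by $p$ and $q$. Then $\mathsf{SA}_{\mathsf{T}_c}$ is the arithmetically progressed permutation with first entry $\mathsf{SA}_{\mathsf{T}_c}[1]=1$ and ratio $k=q^{ -1}$, the multiplicative inverse of $q$ modulo $n$. Equivalently, $\mathsf{T}_c$ equals the binary string $\mathsf{T}$ defined by $\mathsf{T}[i]=\mathtt{a}$ if $i\in\{P[1],\ldots,P[s]\}$ and $\mathtt{b}$ otherwise, where $P$ is that permutation and $s$ is the index with $P[s]=n-k$.
   Context: Alphabet $\{\mathtt{a}<\mathtt{b}\}$; lexicographic order with a proper prefix smaller than the longer string; suffix array $\mathsf{SA}_{\mathsf{T}}$: permutation of $[1..n]$ such that $\mathsf{T}[\mathsf{SA}_{\mathsf{T}}[i]..n]$ is the $i$-th smallest suffix. $x\bmod n$ denotes the representative of $x$ modulo $n$ in $[1..n]$; $x\operatorname{mod}_0 n$ denotes the representative in $[0..n-1]$. An arithmetically progressed permutation of length $n$ with ratio $k\in[1..n-1]$ is a permutation $P$ of $[1..n]$ with $P[i+1]=P[i]+k\bmod n$. Lower Christoffel word determined by coprime $p,q\ge1$: the string $\mathsf{T}_c$ of length $n=p+q$ with, for $i\in[1..n]$, $\mathsf{T}_c[i]=\mathtt{a}$ if $(i-1)q\operatorname{mod}_0 n< iq\operatorname{mod}_0 n$ and $\mathsf{T}_c[i]=\mathtt{b}$ otherwise. (Geometrically, this is the lattice path from $(0,0)$ to $(p,q)$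 with $\mathtt{a}$ = unit step right and $\mathtt{b}$ = unit step up, lying below the segment from $(0,0)$ to $(p,q)$ and enclosing with it no lattice points.) -}

module Defs where

open import Data.Bool using (Bool; true; false; if_then_else_)
import Data.Bool.Properties as Bool
open import Data.Fin using (Fin; toℕ)
open import Data.List using (List; map; upTo; drop; take; length)
open import Data.List.Membership.DecPropositional using (_∈?_)
open import Data.List.Relation.Binary.Lex.NonStrict using (≤-decTotalOrder)
open import Data.List.Relation.Binary.Permutation.Propositional using (_↭_)
open import Data.List.Relation.Unary.Linked using (Linked)
import Data.List.Sort as Sort
open import Data.Nat using (ℕ; suc; _+_; _∸_; _*_; _%_; _≤_; _≡ᵇ_; _<ᵇ_; _≟_; NonZero; nonZero)
open import Data.Product using (_×_)
open import Level using (0ℓ)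
open import Relation.Binary.Bundles using (DecTotalOrder)
import Relation.Binary.Construct.On as On
open import Relation.Binary.PropositionalEquality using (_≡_)
open import Relation.Nullary using (does)

p+q-nonZero : ∀ p q → .{{NonZero p}} → NonZero (p + q)
p+q-nonZero (suc p) q = nonZero

-- The representative of x modulo n in [1 .. n]; the one in [0 .. n - 1] is x % n.
_mod_ : (x n : ℕ) .{{_ : NonZero n}} → ℕ
x mod n = if x % n ≡ᵇ 0 then n else x % n

-- Text positions are numbered from 1 throughout.
[1‥_] : ℕ → List ℕ
[1‥ n ] = map suc (upTo n)

-- The order on Bool has false below true.
Letter : Set
Letter = Bool

pattern a = false
pattern b = true

lexOrder : DecTotalOrder 0ℓ 0ℓ 0ℓ
lexOrder = ≤-decTotalOrder Bool.≤-decTotalOrder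

suffix : List Letter → ℕ → List Letter
suffix T i = drop (i ∸ 1) T

-- Suffixes starting at distinct positions have distinct lengths, so the sorted
-- order of the positions 1, …, length T is unique.
SA : List Letter → List ℕ
SA T = Sort.sort (On.decTotalOrder lexOrder (suffix T)) [1‥ length T ]

christoffel : (p q : ℕ) .{{_ : NonZero p}} → List Letter
christoffel p q = map letter [1‥ n ]
  where
  n : ℕ
  n = p + q

  instance
    n-nonZero : NonZero n
    n-nonZero = p+q-nonZero p q

  letter : ℕ → Letter
  letter i = if ((i ∸ 1) * q) % n <ᵇ (i * q) % n then a else b

IsInverseMod : (n q k : ℕ) .{{_ : NonZero n}} → Set
IsInverseMod n q k = 1 ≤ k × k ≤ n ∸ 1 × (k * q) % n ≡ 1 % n

record IsArithmeticallyProgressed (n k : ℕ) .{{_ : NonZero n}} (P : List ℕ) : Set where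
  field
    1≤k         : 1 ≤ k
    k≤n∸1       : k ≤ n ∸ 1
    permutation : P ↭ [1‥ n ]
    progression : Linked (λ x y → y ≡ (x + k) mod n) P

-- The string of length n with letter a exactly at the positions P[1], …, P[s].
-- The index s is a 0-based Fin, so these are the first suc (toℕ s) entries of P.
prefixString : (n : ℕ) (P : List ℕ) → Fin (length P) → List Letter
prefixString n P s = map letter [1‥ n ]
  where
  letter : ℕ → Letter
  letter i = if does (_∈?_ _≟_ i (take (suc (toℕ s)) P)) then a else b

{-# OPTIONS --safe #-}

-- Put n = p + q and attach to the 0-based position t the residue x t = t q mod n.
-- Passing to the next position adds q when x t < p and subtracts p otherwise, so the
-- letter at t is a exactly when x t < p, and two positions with equal letters have
-- their residues shifted by the same amount. Hence residues x t < x u stay in this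
-- order along the two suffixes until the letters differ, with a on the side of t, or
-- the suffix of t ends; the suffix of u cannot end first, since the residue reached
-- at the end of the word is 0. The suffixes are therefore ordered by residue, and the
-- position with residue j is j k mod n, where k = q⁻¹.
module Submission where

open import Defs
open import Data.Bool using (if_then_else_; f≤t)
open import Data.Fin using (Fin; toℕ; fromℕ<)
open import Data.Fin.Properties using (toℕ-fromℕ<)
open import Data.List using (List; []; _∷_; applyUpTo; drop; head; length; lookup; map; take)
open import Data.List.Membership.DecPropositional using (_∈?_)
open import Data.List.Membership.Propositional using (_∈_)
open import Data.List.Membership.Propositional.Properties using (∈-applyUpTo⁺; ∈-applyUpTo⁻)
open import Data.List.Membership.Propositional.Properties.WithK using (unique∧set⇒bag)
open import Data.List.Properties
  using (length-applyUpTo; length-drop; lookup-applyUpTo; map-applyUpTo; map-cong-local; map-upTo)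
open import Data.List.Relation.Binary.BagAndSetEquality using (∼bag⇒↭)
open import Data.List.Relation.Binary.Lex.NonStrict using (halt; this; next)
open import Data.List.Relation.Binary.Permutation.Propositional using (_↭_; ↭⇒↭ₛ′; ↭-sym; ↭-trans)
open import Data.List.Relation.Binary.Permutation.Propositional.Properties using (All-resp-↭)
open import Data.List.Relation.Binary.Pointwise using (Pointwise; []; _∷_; Pointwise-length)
open import Data.List.Relation.Unary.All using (All; []; _∷_)
import Data.List.Relation.Unary.All.Properties as All
import Data.List.Relation.Unary.Linked.Properties as Linked
open import Data.List.Relation.Unary.Sorted.TotalOrder using (Sorted)
open import Data.List.Relation.Unary.Sorted.TotalOrder.Properties using (↗↭↗⇒≋)
import Data.List.Relation.Unary.Sorted.TotalOrder.Properties as Sorted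
import Data.List.Relation.Unary.Unique.Propositional.Properties as Unique
import Data.List.Sort as Sort
open import Data.Maybe using (just)
open import Data.Nat
  using (ℕ; zero; suc; _+_; _∸_; _*_; _%_; _≤_; _<_; _≟_; _<?_; s≤s; z<s; NonZero; >-nonZero⁻¹)
open import Data.Nat.Coprimality using (Coprime; coprime-Bézout)
open import Data.Nat.GCD using (module Bézout)
open import Data.Nat.DivMod hiding (_mod_)
open import Data.Nat.Properties
open import Data.Nat.Tactic.RingSolver using (solve-∀)
open import Data.Product using (Σ-syntax; ∃-syntax; _×_; _,_)
open import Data.Sum using (inj₁; inj₂)
open import Function using (_∘_; id; _⇔_; mk⇔)
open import Level using (0ℓ)
open import Relation.Binary.Bundles using (DecTotalOrder)
import Relation.Binary.Construct.On as On
open import Relation.Binary.PropositionalEquality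
open import Relation.Nullary using (does; yes; no; contradiction)
open import Relation.Nullary.Decidable using (dec-true; dec-false; does-⇔)

open ≡-Reasoning

private
  variable
    A : Set

-- Tabulated lists and permutations

drop-applyUpTo : ∀ (f : ℕ → A) m o → drop m (applyUpTo f (m + o)) ≡ applyUpTo (f ∘ (m +_)) o
drop-applyUpTo f zero    o = refl
drop-applyUpTo f (suc m) o = drop-applyUpTo (f ∘ suc) m o

take-applyUpTo : ∀ (f : ℕ → A) m o → take m (applyUpTo f (m + o)) ≡ applyUpTo f m
take-applyUpTo f zero    o = refl
take-applyUpTo f (suc m) o = cong (f 0 ∷_) (take-applyUpTo (f ∘ suc) m o)

-- The inverse `g` makes `f` injective and onto below n, so both lists are duplicate-free with the
-- same members, which makes them permutations of each other.
applyUpTo-inverse-↭ : ∀ {f g : ℕ → ℕ} n →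
  (∀ {i} → i < n → f i < n) → (∀ {i} → i < n → g i < n) →
  (∀ {i} → i < n → g (f i) ≡ i) → (∀ {i} → i < n → f (g i) ≡ i) →
  applyUpTo (suc ∘ f) n ↭ [1‥ n ]
applyUpTo-inverse-↭ {f} {g} n f< g< gf fg =
  subst (applyUpTo (suc ∘ f) n ↭_) (sym (map-upTo suc n))
    (∼bag⇒↭ (unique∧set⇒bag
      (Unique.applyUpTo⁺₁ _ n λ i<j j<n eq → <⇒≢ i<j
        (trans (sym (gf (<-trans i<j j<n))) (trans (cong g (suc-injective eq)) (gf j<n))))
      (Unique.applyUpTo⁺₁ _ n λ i<j _ → <⇒≢ i<j ∘ suc-injective)
      (mk⇔ to from)))
  where
  to : ∀ {i} → i ∈ applyUpTo (suc ∘ f) n → i ∈ applyUpTo suc n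
  to i∈ with _ , j<n , refl ← ∈-applyUpTo⁻ (suc ∘ f) i∈ = ∈-applyUpTo⁺ suc (f< j<n)

  from : ∀ {i} → i ∈ applyUpTo suc n → i ∈ applyUpTo (suc ∘ f) n
  from i∈ with _ , j<n , refl ← ∈-applyUpTo⁻ suc i∈ =
    subst (_∈ applyUpTo (suc ∘ f) n) (cong suc (fg j<n)) (∈-applyUpTo⁺ (suc ∘ f) (g< j<n))

-- Meant for equality of suffixes as `R`: it forces equal positions only inside the text, hence the
-- restriction to `Q`.
Pointwise-local⇒≡ : ∀ {Q : A → Set} {R : A → A → Set} →
  (∀ {x y} → Q x → Q y → R x y → x ≡ y) →
  ∀ {xs ys} → All Q xs → All Q ys → Pointwise R xs ys → xs ≡ ys
Pointwise-local⇒≡ R⇒≡ []         []         []         = refl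
Pointwise-local⇒≡ R⇒≡ (qx ∷ qxs) (qy ∷ qys) (r ∷ rs) =
  cong₂ _∷_ (R⇒≡ qx qy r) (Pointwise-local⇒≡ R⇒≡ qxs qys rs)

-- Uniqueness of the suffix array

suffixOrder : List Letter → DecTotalOrder 0ℓ 0ℓ 0ℓ
suffixOrder T = On.decTotalOrder lexOrder (suffix T)

-- Two sorted arrangements of the same positions agree up to equality of suffixes, and the length of
-- a suffix determines its position.
SA-unique : ∀ T {P} → P ↭ [1‥ length T ] →
            Sorted (DecTotalOrder.totalOrder (suffixOrder T)) P → SA T ≡ P
SA-unique T {P} P↭ P↗ = Pointwise-local⇒≡ suffix-injective
  (All-resp-↭ (↭-sym SA↭) positions) (All-resp-↭ (↭-sym P↭) positions)
  (↗↭↗⇒≋ totalOrder (sort-↗ _) P↗ (↭⇒↭ₛ′ Eq.isEquivalence (↭-trans SA↭ (↭-sym P↭))))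
  where
  open DecTotalOrder (suffixOrder T) using (totalOrder; _≈_; module Eq)
  open Sort (suffixOrder T) using (sort-↭; sort-↗)

  Position : ℕ → Set
  Position i = ∃[ t ] t < length T × i ≡ suc t

  SA↭ : SA T ↭ [1‥ length T ]
  SA↭ = sort-↭ _

  positions : All Position [1‥ length T ]
  positions = All.map⁺ (All.applyUpTo⁺₁ id (length T) λ t< → _ , t< , refl)

  suffix-injective : ∀ {i j} → Position i → Position j → i ≈ j → i ≡ j
  suffix-injective (t , t< , refl) (u , u< , refl) eq = cong suc (∸-cancelˡ-≡ (<⇒≤ t<) (<⇒≤ u<)
    (trans (sym (length-drop t T)) (trans (Pointwise-length eq) (length-drop u T))))

-- Residues and inverses modulo n

module _ (n : ℕ) .{{_ : NonZero n}} where

  [m+o%n]%n≡[m+o]%n : ∀ m o → (m + o % n) % n ≡ (m + o) % n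
  [m+o%n]%n≡[m+o]%n m o = begin
    (m + o % n) % n         ≡⟨ %-distribˡ-+ m (o % n) n ⟩
    (m % n + o % n % n) % n ≡⟨ cong (λ r → (m % n + r) % n) (m%n%n≡m%n o n) ⟩
    (m % n + o % n) % n     ≡⟨ %-distribˡ-+ m o n ⟨
    (m + o) % n             ∎

  [m%n*o]%n≡[m*o]%n : ∀ m o → (m % n * o) % n ≡ (m * o) % n
  [m%n*o]%n≡[m*o]%n m o = begin
    (m % n * o) % n           ≡⟨ %-distribˡ-* (m % n) o n ⟩
    (m % n % n * (o % n)) % n ≡⟨ cong (λ r → (r * (o % n)) % n) (m%n%n≡m%n m n) ⟩
    (m % n * (o % n)) % n     ≡⟨ %-distribˡ-* m o n ⟨
    (m * o) % n               ∎

  -- Links 0-based and 1-based representatives; the second case is the residue n - 1, where `_mod_`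
  -- returns n in place of 0.
  suc-%-mod : ∀ m → suc (m % n) ≡ suc m mod n
  suc-%-mod m with m≤n⇒m<n∨m≡n (m%n<n m n)
  ... | inj₁ 1+r<n rewrite trans (sym ([m+o%n]%n≡[m+o]%n 1 m)) (m<n⇒m%n≡m 1+r<n) = refl
  ... | inj₂ 1+r≡n rewrite trans (sym ([m+o%n]%n≡[m+o]%n 1 m)) (trans (cong (_% n) 1+r≡n) (n%n≡0 n)) = 1+r≡n

  -- Used with `k` and `q` in both roles, so that multiplication by each undoes the other on
  -- residues.
  *-inverse-cancel : ∀ {k q} → (k * q) % n ≡ 1 % n → ∀ {r} → r < n → ((r * k) % n * q) % n ≡ r
  *-inverse-cancel {k} {q} kq≡1 {r} r<n = begin
    ((r * k) % n * q) % n       ≡⟨ [m%n*o]%n≡[m*o]%n (r * k) q ⟩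
    (r * k * q) % n             ≡⟨ cong (_% n) (*-assoc r k q) ⟩
    (r * (k * q)) % n           ≡⟨ %-distribˡ-* r (k * q) n ⟩
    (r % n * ((k * q) % n)) % n ≡⟨ cong (λ s → (r % n * s) % n) kq≡1 ⟩
    (r % n * (1 % n)) % n       ≡⟨ %-distribˡ-* r 1 n ⟨
    (r * 1) % n                 ≡⟨ cong (_% n) (*-identityʳ r) ⟩
    r % n                       ≡⟨ m<n⇒m%n≡m r<n ⟩
    r                           ∎

  inverse-mod : ∀ {k q} → 1 < n → (k * q) % n ≡ 1 % n → IsInverseMod n q (k % n)
  inverse-mod {k} {q} 1<n kq≡1 = n≢0⇒n>0 k%n≢0 , <⇒≤pred (m%n<n k n) , trans ([m%n*o]%n≡[m*o]%n k q) kq≡1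
    where
    k%n≢0 : k % n ≢ 0
    k%n≢0 k%n≡0 = 0≢1+n (begin
      0               ≡⟨ m<n⇒m%n≡m (<-trans z<s 1<n) ⟨
      (0 * q) % n     ≡⟨ cong (λ r → (r * q) % n) k%n≡0 ⟨
      (k % n * q) % n ≡⟨ [m%n*o]%n≡[m*o]%n k q ⟩
      (k * q) % n     ≡⟨ kq≡1 ⟩
      1 % n           ≡⟨ m<n⇒m%n≡m 1<n ⟩
      1               ∎)

-- Since p ≡ -q modulo n, a Bézout identity for p and q turns into (x + y) q ≡ ±1, with the sign
-- given by its constructor.
coprime-inverse : ∀ p₀ q → .{{NonZero q}} → Coprime (suc p₀) q → ∃[ k ] IsInverseMod (suc p₀ + q) q k
coprime-inverse p₀ q coprime = _ , inverse-mod n {inverse identity} 1<n (kq≡1 identity)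
  where
  p n : ℕ
  p = suc p₀
  n = p + q

  identity : Bézout.Identity 1 p q
  identity = coprime-Bézout coprime

  1<n : 1 < n
  1<n = s≤s (≤-trans (>-nonZero⁻¹ q) (m≤n+m q p₀))

  inverse : Bézout.Identity 1 p q → ℕ
  inverse (Bézout.+- x y _) = (x + y) * (p₀ + q)
  inverse (Bézout.-+ x y _) = x + y

  kq≡1 : ∀ identity → (inverse identity * q) % n ≡ 1 % n
  kq≡1 (Bézout.-+ x y 1+xp≡yq) = begin
    ((x + y) * q) % n         ≡⟨ cong (_% n) (*-distribʳ-+ q x y) ⟩
    (x * q + y * q) % n       ≡⟨ cong (λ m → (x * q + m) % n) 1+xp≡yq ⟨
    (x * q + (1 + x * p)) % n ≡⟨ cong (_% n) (rearrange x q p) ⟩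
    (1 + x * n) % n           ≡⟨ [m+kn]%n≡m%n 1 x n ⟩
    1 % n                     ∎
    where
    rearrange : ∀ x q p → x * q + (1 + x * p) ≡ 1 + x * (p + q)
    rearrange = solve-∀
  -- Here (x + y) q ≡ −1, and the factor n − 1 corrects the sign; multiples of n are
  -- added to both sides so that no subtraction occurs.
  kq≡1 (Bézout.+- x y 1+yq≡xp) = begin
    (k * q) % n                                  ≡⟨ [m+kn]%n≡m%n (k * q) (x + 1) n ⟨
    (k * q + (x + 1) * n) % n                    ≡⟨ cong (_% n) (expand x y p₀ q) ⟩
    (c * (p₀ + q) + (x * p + x * q + n)) % n     ≡⟨ cong (λ m → (c * (p₀ + q) + (m + x * q + n)) % n) 1+yq≡xp ⟨
    (c * (p₀ + q) + (1 + y * q + x * q + n)) % n ≡⟨ cong (_% n) (collect x y p₀ q) ⟩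
    (1 + ((x + y) * q + 1) * n) % n              ≡⟨ [m+kn]%n≡m%n 1 ((x + y) * q + 1) n ⟩
    1 % n                                        ∎
    where
    k c : ℕ
    k = (x + y) * (p₀ + q)
    c = (x + y) * q
    expand : ∀ x y p₀ q → (x + y) * (p₀ + q) * q + (x + 1) * (suc p₀ + q) ≡
                          (x + y) * q * (p₀ + q) + (x * suc p₀ + x * q + (suc p₀ + q))
    expand = solve-∀
    collect : ∀ x y p₀ q → (x + y) * q * (p₀ + q) + (1 + y * q + x * q + (suc p₀ + q)) ≡
                           1 + ((x + y) * q + 1) * (suc p₀ + q)
    collect = solve-∀

-- Lexicographic comparison of residue orbits

module ResidueOrder (p q : ℕ) where

  letter : ℕ → Letter
  letter x = if does (x <? p) then a else b

  letter-a : ∀ {x} → x < p → letter x ≡ a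
  letter-a {x} x<p rewrite dec-true (x <? p) x<p = refl

  letter-b : ∀ {x} → p ≤ x → letter x ≡ b
  letter-b {x} p≤x rewrite dec-false (x <? p) (≤⇒≯ p≤x) = refl

  -- Addition of q modulo p + q, freed of `%`. The equation in `down` avoids truncated subtraction
  -- and already contains p ≤ x.
  data Step (x y : ℕ) : Set where
    up   : x < p → y ≡ q + x → Step x y
    down : x ≡ p + y → Step x y

  Orbit : (ℕ → ℕ) → Set
  Orbit x = ∀ i → Step (x i) (x (suc i))

  open DecTotalOrder lexOrder using () renaming (_≤_ to _≤ₗₑₓ_)

  -- Orbits are arbitrary sequences so that the induction can pass to their tails; equal letters
  -- mean equal shifts, which preserve x 0 < y 0.
  orbit-≤ : ∀ {x y} m o → Orbit x → Orbit y → x 0 < y 0 → y o ≡ 0 →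
            applyUpTo (letter ∘ x) m ≤ₗₑₓ applyUpTo (letter ∘ y) o
  -- An exhausted second list would give y 0 = 0, which cannot exceed x 0.
  orbit-≤ m zero _ _ x<y y≡0 = contradiction (subst (_ <_) y≡0 x<y) (λ ())
  orbit-≤ zero (suc o) _ _ _ _ = halt
  orbit-≤ {x} {y} (suc m) (suc o) X Y x<y y≡0 with X 0 | Y 0
  ... | up x<p x₁≡ | up y<p y₁≡ =
    next (trans (letter-a x<p) (sym (letter-a y<p)))
      (orbit-≤ m o (X ∘ suc) (Y ∘ suc) (subst₂ _<_ (sym x₁≡) (sym y₁≡) (+-monoʳ-< q x<y)) y≡0)
  -- The first difference: a against b settles the comparison.
  ... | up x<p _ | down y≡
    rewrite letter-a x<p | letter-b (≤-trans (m≤m+n p _) (≤-reflexive (sym y≡))) = this (f≤t , λ ())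
  ... | down x≡ | up y<p _ =
    contradiction (<-trans x<y y<p) (≤⇒≯ (≤-trans (m≤m+n p _) (≤-reflexive (sym x≡))))
  ... | down x≡ | down y≡ =
    next (trans (letter-b (≤-trans (m≤m+n p _) (≤-reflexive (sym x≡))))
                (sym (letter-b (≤-trans (m≤m+n p _) (≤-reflexive (sym y≡))))))
      (orbit-≤ m o (X ∘ suc) (Y ∘ suc) (+-cancelˡ-< p _ _ (subst₂ _<_ x≡ y≡ x<y)) y≡0)

-- Residues and suffixes of the Christoffel word

module Christoffel (p₀ q k : ℕ) .{{_ : NonZero q}}
                   (kq≡1 : (k * q) % (suc p₀ + q) ≡ 1 % (suc p₀ + q)) where

  p n : ℕ
  p = suc p₀
  n = p + q

  open ResidueOrder p q

  x : ℕ → ℕ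
  x t = (t * q) % n

  x<n : ∀ t → x t < n
  x<n t = m%n<n (t * q) n

  x-step : ∀ t → Step (x t) (x (suc t))
  x-step t with x t <? p
  ... | yes x<p = up x<p (begin
    (q + t * q) % n ≡⟨ [m+o%n]%n≡[m+o]%n n q (t * q) ⟨
    -- No wrap occurs, as x t < p keeps the sum below p + q.
    (q + x t) % n   ≡⟨ m<n⇒m%n≡m (<-≤-trans (+-monoʳ-< q x<p) (≤-reflexive (+-comm q p))) ⟩
    q + x t         ∎)
  ... | no x≮p = down (begin
    x t           ≡⟨ m+[n∸m]≡n p≤x ⟨
    p + (x t ∸ p) ≡⟨ cong (p +_) (sym x₁≡) ⟩
    p + x (suc t) ∎)
    where
    p≤x : p ≤ x t
    p≤x = ≮⇒≥ x≮p
    x₁≡ : x (suc t) ≡ x t ∸ p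
    x₁≡ = begin
      (q + t * q) % n         ≡⟨ [m+o%n]%n≡[m+o]%n n q (t * q) ⟨
      (q + x t) % n           ≡⟨ cong (λ y → (q + y) % n) (m∸n+n≡m p≤x) ⟨
      (q + (x t ∸ p + p)) % n ≡⟨ cong (_% n) (trans (+-comm q _) (+-assoc (x t ∸ p) p q)) ⟩
      (x t ∸ p + n) % n       ≡⟨ [m+n]%n≡m%n (x t ∸ p) n ⟩
      (x t ∸ p) % n           ≡⟨ m<n⇒m%n≡m (≤-<-trans (m∸n≤m (x t) p) (x<n t)) ⟩
      x t ∸ p                 ∎

  -- Reconciles the ascent test in the definition of the word with the threshold p: `up` rises by q
  -- > 0, while `down` cannot rise.
  x-ascent : ∀ t → x t < x (suc t) ⇔ x t < p
  x-ascent t with x-step t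
  ... | up x<p x₁≡ = mk⇔ (λ _ → x<p) (λ _ → subst (x t <_) (sym x₁≡) (m<n+m (x t) (>-nonZero⁻¹ q)))
  ... | down x≡ = mk⇔
    (λ x<x₁ → contradiction x<x₁ (≤⇒≯ (≤-trans (m≤n+m _ p) (≤-reflexive (sym x≡)))))
    (λ x<p → contradiction x<p (≤⇒≯ (≤-trans (m≤m+n p _) (≤-reflexive (sym x≡)))))

  T : List Letter
  T = christoffel p q

  T≡ : T ≡ applyUpTo (letter ∘ x) n
  T≡ = begin
    T                                           ≡⟨ map-cong-[1‥] ⟩
    map (letter ∘ x ∘ (_∸ 1)) [1‥ n ]           ≡⟨ cong (map _) (map-upTo suc n) ⟩
    map (letter ∘ x ∘ (_∸ 1)) (applyUpTo suc n) ≡⟨ map-applyUpTo suc _ n ⟩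
    applyUpTo (letter ∘ x) n                    ∎
    where
    map-cong-[1‥] : T ≡ map (letter ∘ x ∘ (_∸ 1)) [1‥ n ]
    map-cong-[1‥] = map-cong-local (All.map⁺ (All.applyUpTo⁺₂ id n λ t →
      -- `does` of `_<?_` computes to the `_<ᵇ_` used in `christoffel`.
      cong (if_then a else b) (does-⇔ (x-ascent t) (x t <? x (suc t)) (x t <? p))))

  length-T : length T ≡ n
  length-T = trans (cong length T≡) (length-applyUpTo (letter ∘ x) n)

  suffix-T : ∀ {t} → t < n → suffix T (suc t) ≡ applyUpTo (λ i → letter (x (t + i))) (n ∸ t)
  suffix-T {t} t<n = begin
    drop t T                                      ≡⟨ cong (drop t) T≡ ⟩
    drop t (applyUpTo (letter ∘ x) n)             ≡⟨ cong (drop t ∘ applyUpTo _) (m+[n∸m]≡n (<⇒≤ t<n)) ⟨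
    drop t (applyUpTo (letter ∘ x) (t + (n ∸ t))) ≡⟨ drop-applyUpTo _ t (n ∸ t) ⟩
    applyUpTo (λ i → letter (x (t + i))) (n ∸ t)  ∎

  open DecTotalOrder lexOrder using () renaming (_≤_ to _≤ₗₑₓ_)

  suffix-mono : ∀ {t u} → t < n → u < n → x t < x u → suffix T (suc t) ≤ₗₑₓ suffix T (suc u)
  suffix-mono {t} {u} t<n u<n xt<xu = subst₂ _≤ₗₑₓ_ (sym (suffix-T t<n)) (sym (suffix-T u<n))
    (orbit-≤ (n ∸ t) (n ∸ u) (orbit t) (orbit u)
      (subst₂ (λ i j → x i < x j) (sym (+-identityʳ t)) (sym (+-identityʳ u)) xt<xu)
      -- Every suffix runs to index n of `x`, where n q ≡ 0.
      (begin
        x (u + (n ∸ u)) ≡⟨ cong x (m+[n∸m]≡n (<⇒≤ u<n)) ⟩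
        (n * q) % n     ≡⟨ cong (_% n) (*-comm n q) ⟩
        (q * n) % n     ≡⟨ m*n%n≡0 q n ⟩
        0               ∎))
    where
    orbit : ∀ t → Orbit (λ i → x (t + i))
    orbit t i = subst (Step (x (t + i)) ∘ x) (sym (+-suc t i)) (x-step (t + i))

  -- The progression as suffix array

  pos : ℕ → ℕ
  pos j = (j * k) % n

  pos<n : ∀ j → pos j < n
  pos<n j = m%n<n (j * k) n

  x-pos : ∀ {j} → j < n → x (pos j) ≡ j
  x-pos = *-inverse-cancel n kq≡1

  pos-x : ∀ {t} → t < n → pos (x t) ≡ t
  pos-x = *-inverse-cancel n (trans (cong (_% n) (*-comm q k)) kq≡1)

  P : List ℕ
  P = applyUpTo (suc ∘ pos) n

  P-↭ : P ↭ [1‥ n ]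
  P-↭ = applyUpTo-inverse-↭ n (λ {j} _ → pos<n j) (λ {t} _ → x<n t) x-pos pos-x

  P-progression : ∀ j → suc (pos (suc j)) ≡ (suc (pos j) + k) mod n
  P-progression j = begin
    suc ((k + j * k) % n) ≡⟨ cong suc ([m+o%n]%n≡[m+o]%n n k (j * k)) ⟨
    suc ((k + pos j) % n) ≡⟨ suc-%-mod n (k + pos j) ⟩
    suc (k + pos j) mod n ≡⟨ cong (λ m → suc m mod n) (+-comm k (pos j)) ⟩
    suc (pos j + k) mod n ∎

  -- Consecutive entries of `P` have residues `j` and `suc j`, so `suffix-mono` shows that `P` is
  -- sorted.
  SA≡P : SA T ≡ P
  SA≡P = SA-unique T (subst (λ m → P ↭ [1‥ m ]) (sym length-T) P-↭)
    (Sorted.applyUpTo⁺₁ (DecTotalOrder.totalOrder (suffixOrder T)) (suc ∘ pos) n λ {j} 1+j<n →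
      suffix-mono (pos<n j) (pos<n (suc j))
        (subst₂ _<_ (sym (x-pos (<-trans (n<1+n j) 1+j<n))) (sym (x-pos 1+j<n)) (n<1+n j)))

  -- The letters a as a prefix of the progression

  p₀<length-P : p₀ < length P
  p₀<length-P = subst (p₀ <_) (sym (length-applyUpTo (suc ∘ pos) n)) (s≤s (m≤m+n p₀ q))

  -- The letter a belongs to the residues 0, ..., p - 1, which are the 0-based indices of the first
  -- p entries of `P`; the last of them is `p₀`.
  s : Fin (length P)
  s = fromℕ< p₀<length-P

  -- With r = n − 1 − k, the claim pos p₀ = r follows from r ≡ r + k n = n − 1 + k p₀ + k q ≡ k p₀.
  P[s]≡n∸k : k ≤ n ∸ 1 → lookup P s ≡ n ∸ k
  P[s]≡n∸k k≤n∸1 = begin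
    lookup P s                            ≡⟨ lookup-applyUpTo (suc ∘ pos) n s ⟩
    suc (pos (toℕ s))                     ≡⟨ cong (suc ∘ pos) (toℕ-fromℕ< p₀<length-P) ⟩
    suc ((p₀ * k) % n)                    ≡⟨ cong suc ([m+n]%n≡m%n (p₀ * k) n) ⟨
    suc ((p₀ * k + n) % n)                ≡⟨ cong (λ m → suc (m % n)) (+-suc (p₀ * k) (p₀ + q)) ⟩
    suc (suc (p₀ * k + (p₀ + q)) % n)     ≡⟨ cong (λ m → suc (m % n)) (+-comm 1 (p₀ * k + (p₀ + q))) ⟩
    suc ((p₀ * k + (p₀ + q) + 1) % n)     ≡⟨ cong suc 1≡kq ⟩
    suc ((p₀ * k + (p₀ + q) + k * q) % n) ≡⟨ cong (λ m → suc ((p₀ * k + m + k * q) % n)) (m∸n+n≡m k≤n∸1) ⟨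
    suc ((p₀ * k + (r + k) + k * q) % n)  ≡⟨ cong (λ m → suc (m % n)) (collect p₀ q k r) ⟩
    suc ((r + k * n) % n)                 ≡⟨ cong suc ([m+kn]%n≡m%n r k n) ⟩
    suc (r % n)                           ≡⟨ cong suc (m<n⇒m%n≡m (s≤s (m∸n≤m (p₀ + q) k))) ⟩
    suc r                                 ≡⟨ +-∸-assoc 1 k≤n∸1 ⟨
    n ∸ k                                 ∎
    where
    r : ℕ
    r = p₀ + q ∸ k
    1≡kq : (p₀ * k + (p₀ + q) + 1) % n ≡ (p₀ * k + (p₀ + q) + k * q) % n
    1≡kq = begin
      (p₀ * k + (p₀ + q) + 1) % n           ≡⟨ [m+o%n]%n≡[m+o]%n n (p₀ * k + (p₀ + q)) 1 ⟨
      (p₀ * k + (p₀ + q) + 1 % n) % n       ≡⟨ cong (λ m → (p₀ * k + (p₀ + q) + m) % n) kq≡1 ⟨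
      (p₀ * k + (p₀ + q) + (k * q) % n) % n ≡⟨ [m+o%n]%n≡[m+o]%n n (p₀ * k + (p₀ + q)) (k * q) ⟩
      (p₀ * k + (p₀ + q) + k * q) % n       ∎
    collect : ∀ p₀ q k r → p₀ * k + (r + k) + k * q ≡ r + k * (suc p₀ + q)
    collect = solve-∀

  take-P : take (suc (toℕ s)) P ≡ applyUpTo (suc ∘ pos) p
  take-P = trans (cong (λ m → take (suc m) P) (toℕ-fromℕ< p₀<length-P)) (take-applyUpTo (suc ∘ pos) p q)

  -- As `x` and `pos` are mutually inverse, a position is listed in `P` at the index given by its
  -- residue.
  x<p⇔∈take-P : ∀ {t} → t < n → x t < p ⇔ suc t ∈ take (suc (toℕ s)) P
  x<p⇔∈take-P {t} t<n = subst (λ ps → x t < p ⇔ suc t ∈ ps) (sym take-P) (mk⇔ to from)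
    where
    to : x t < p → suc t ∈ applyUpTo (suc ∘ pos) p
    to xt<p = subst (_∈ applyUpTo (suc ∘ pos) p) (cong suc (pos-x t<n)) (∈-applyUpTo⁺ (suc ∘ pos) xt<p)

    from : suc t ∈ applyUpTo (suc ∘ pos) p → x t < p
    from t∈ with j , j<p , refl ← ∈-applyUpTo⁻ (suc ∘ pos) t∈ =
      subst (_< p) (sym (x-pos (<-≤-trans j<p (m≤m+n p q)))) j<p

  T≡prefixString : T ≡ prefixString n P s
  T≡prefixString = map-cong-local (All.map⁺ (All.applyUpTo⁺₁ id n λ {t} t<n →
    cong (if_then a else b) (trans
      (does-⇔ (x-ascent t) (x t <? x (suc t)) (x t <? p))
      (does-⇔ (x<p⇔∈take-P t<n) (x t <? p) (_∈?_ _≟_ (suc t) (take (suc (toℕ s)) P))))))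

theorem12 : (p q : ℕ) .{{_ : NonZero p}} .{{_ : NonZero q}} → Coprime p q →
  let n = p + q
      instance
        n-nonZero : NonZero n
        n-nonZero = p+q-nonZero p q
  in
  Σ[ k ∈ ℕ ] IsInverseMod n q k ×
  (Σ[ P ∈ List ℕ ]
    IsArithmeticallyProgressed n k P × head P ≡ just 1 ×
    SA (christoffel p q) ≡ P ×
    (Σ[ s ∈ Fin (length P) ]
      lookup P s ≡ n ∸ k ×
      christoffel p q ≡ prefixString n P s))
theorem12 (suc p₀) q coprime with k , inv@(1≤k , k≤n∸1 , kq≡1) ← coprime-inverse p₀ q coprime =
  k , inv , P ,
  record { 1≤k = 1≤k ; k≤n∸1 = k≤n∸1 ; permutation = P-↭
         ; progression = Linked.applyUpTo⁺₂ (suc ∘ pos) n P-progression } ,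
  -- The first entry needs only `refl`, because `pos 0` computes to 0.
  refl , SA≡P , s , P[s]≡n∸k k≤n∸1 , T≡prefixString
  where open Christoffel p₀ q k kq≡1
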